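{- For every $n$-HCFP $\mathcal{H}$ and every regular set $S$ of $n$-stores, the set $\mathit{pre}^*_{\mathcal{H}}(S)$ is regular, and a finite automaton (equivalently, a nested store automaton) recognizing it is effectively computable from $\mathcal{H}$ and a finite automaton recognizing $S$.
   Context: Higher-order stores over a finite alphabet $\Gamma$: a 1-store is a sequence $[a_1\ldots a_l]$, $a_i\in\Gamma$, $l\ge0$; for $n\ge2$ an $n$-store is a nonempty sequence $[s_1\ldots s_l]$ of $(n-1)$-stores. An $n$-store is identified with its word $w(s)=[w(s_1)\ldots w(s_l)]$ over $\Gamma'=\Gamma\cup\{[,]\}$; a set of $n$-stores is regular if its set of words is accepted by a finite automaton over $\Gamma'$. Operations: on 1-stores, $\mathit{push}_1^w([a_1\ldots a_l])=[w a_2\ldots a_l]$ for $w\in\Gamma^*$ and $\mathit{top}_1([a_1\ldots a_l])=a_1$ (defined only when $l\ge1$). On $n$-stores $s=[s_1\ldots s_l]$, $n>1$: $\mathit{push}_1^w(s)=[\mathit{push}_1^w(s_1)\,s_2\ldots s_l]$; for $2\le k<n$, $\mathit{push}_k(s)=[\mathit{push}_k(s_1)\,s_2\ldots s_l]$ and $\mathit{pop}_k(s)=[\mathit{pop}_k(s_1)\,s_2\ldots s_l]$; $\mathit{push}_n(s)=[s_1 s_1 s_2\ldots s_l]$; $\mathit{pop}_n(s)=[s_2\ldots s_l]$ if $l>1$, undefined otherwise; $\mathit{top}_k(s)=\mathit{top}_k(s_1)$ for $k<n$, $\mathit{top}_n(s)=s_1$. $O_n=\{\mathit{push}_k,\mathit{pop}_k\mid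 k\in[2,n]\}\cup\{\mathit{push}_1^w\mid w\in\Gamma^*\}$. An $n$-HCFP is $\mathcal{H}=(\Gamma,\Delta)$ with $\Delta\subseteq\Gamma\times O_n$ finite; configurations are $n$-stores, and $s\hookrightarrow s'$ iff there is $(a,o)\in\Delta$ with $\mathit{top}_1(s)=a$ and $s'=o(s)$ (defined). $\overset{*}{\hookrightarrow}$ is the reflexive-transitive closure of $\hookrightarrow$, and $\mathit{pre}^*_{\mathcal{H}}(S)=\{s\mid\exists s'\in S,\ s\overset{*}{\hookrightarrow}s'\}$. -}

module Defs where

open import Data.Bool.Base using (if_then_else_)
open import Data.Fin.Base using (Fin)
open import Data.Fin.Subset using (Subset) renaming (_∈_ to _∈ˢ_)
open import Data.List.Base using (List; []; _∷_; _++_; map; concatMap)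
open import Data.List.Membership.Propositional using () renaming (_∈_ to _∈ˡ_)
open import Data.List.NonEmpty.Base using (List⁺; _∷_; toList)
open import Data.List.Relation.Binary.Pointwise.Base using (Pointwise)
open import Data.Maybe.Base using (Maybe; just; nothing)
import Data.Maybe.Base as Maybe
open import Data.Nat.Base using (ℕ; zero; suc; _+_; _≤_)
open import Data.Nat.Properties using (_≟_)
open import Data.Product.Base using (∃-syntax; _×_; _,_)
open import Function.Bundles using (_⇔_)
open import Level using (0ℓ)
open import Relation.Binary.Construct.Closure.ReflexiveTransitive using (Star)
open import Relation.Binary.PropositionalEquality.Core using (_≡_)
open import Relation.Nullary.Decidable.Core using (does)
open import Relation.Unary using (Pred; _∈_)

-- The alphabet A need not be finite, so that nested store automata can be
-- automata over automata; the transition relation is a finite list.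
record FA (A : Set) : Set where
  field
    size        : ℕ
    start       : Fin size
    final       : Subset size
    transitions : List (Fin size × A × Fin size)

  State : Set
  State = Fin size

module _ {A : Set} (M : FA A) where
  open FA M

  data Run : State → List A → State → Set where
    []  : ∀ {q} → Run q [] q
    _∷_ : ∀ {p a q w r} → (p , a , q) ∈ˡ transitions → Run q w r →
          Run p (a ∷ w) r

  Accepts : Pred (List A) 0ℓ
  Accepts w = ∃[ q ] q ∈ˢ final × Run start w q

data Store (Γ : Set) : ℕ → Set where
  [_]₁ : List Γ → Store Γ 1
  [_]ₙ : ∀ {n} → List⁺ (Store Γ (suc n)) → Store Γ (2 + n)

data Γ′ (Γ : Set) : Set where
  letter   : Γ → Γ′ Γ
  ⟦ ⟧      : Γ′ Γ

module _ {Γ : Set} where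

  word : ∀ {n} → Store Γ n → List (Γ′ Γ)
  word {suc zero}    [ as ]₁ = ⟦ ∷ map letter as ++ ⟧ ∷ []
  word {suc (suc n)} [ ss ]ₙ = ⟦ ∷ concatMap (word {suc n}) (toList ss) ++ ⟧ ∷ []

  infix 4 _Recognizes_

  -- Quantifies over all words, so words that encode no store are rejected.
  _Recognizes_ : ∀ {n} → FA (Γ′ Γ) → Pred (Store Γ n) 0ℓ → Set
  M Recognizes S = ∀ w → Accepts M w ⇔ (∃[ s ] s ∈ S × word s ≡ w)

  Regular : ∀ {n} → Pred (Pred (Store Γ n) 0ℓ) 0ℓ
  Regular S = ∃[ M ] M Recognizes S

  top₁ : ∀ {n} → Store Γ n → Maybe Γ
  top₁ [ []       ]₁ = nothing
  top₁ [ a ∷ as   ]₁ = just a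
  top₁ [ s ∷ ss   ]ₙ = top₁ s

  push₁ : ∀ {n} → List Γ → Store Γ n → Maybe (Store Γ n)
  push₁ w [ []     ]₁ = nothing
  push₁ w [ a ∷ as ]₁ = just [ w ++ as ]₁
  push₁ w [ s ∷ ss ]ₙ = Maybe.map (λ s′ → [ s′ ∷ ss ]ₙ) (push₁ w s)

  -- In pushₖ and popₖ the case of 1-stores never arises for 2 ≤ k ≤ n.
  pushₖ : ∀ {n} → ℕ → Store Γ n → Maybe (Store Γ n)
  pushₖ k [ _ ]₁ = nothing
  pushₖ k ([_]ₙ {n} (s ∷ ss)) =
    if does (k ≟ 2 + n)
      then just [ s ∷ s ∷ ss ]ₙ
      else Maybe.map (λ s′ → [ s′ ∷ ss ]ₙ) (pushₖ k s)

  pop-head : ∀ {n} → List⁺ (Store Γ (suc n)) → Maybe (Store Γ (2 + n))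
  pop-head (s ∷ [])      = nothing
  pop-head (s ∷ s′ ∷ ss) = just [ s′ ∷ ss ]ₙ

  popₖ : ∀ {n} → ℕ → Store Γ n → Maybe (Store Γ n)
  popₖ k [ _ ]₁ = nothing
  popₖ k ([_]ₙ {n} (s ∷ ss)) =
    if does (k ≟ 2 + n)
      then pop-head (s ∷ ss)
      else Maybe.map (λ s′ → [ s′ ∷ ss ]ₙ) (popₖ k s)

data Op (Γ : Set) (n : ℕ) : Set where
  push₁-op : List Γ → Op Γ n
  push-op  : (k : ℕ) → 2 ≤ k → k ≤ n → Op Γ n
  pop-op   : (k : ℕ) → 2 ≤ k → k ≤ n → Op Γ n

HCFP : Set → ℕ → Set
HCFP Γ n = List (Γ × Op Γ n)

module _ {Γ : Set} {n : ℕ} where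

  apply : Op Γ n → Store Γ n → Maybe (Store Γ n)
  apply (push₁-op w)    = push₁ w
  apply (push-op k _ _) = pushₖ k
  apply (pop-op  k _ _) = popₖ k

  Step : HCFP Γ n → Store Γ n → Store Γ n → Set
  Step Δ s s′ =
    ∃[ a ] ∃[ o ] (a , o) ∈ˡ Δ × top₁ s ≡ just a × apply o s ≡ just s′

  pre* : HCFP Γ n → Pred (Store Γ n) 0ℓ → Pred (Store Γ n) 0ℓ
  pre* Δ S s = ∃[ s′ ] s′ ∈ S × Star (Step Δ) s s′

data NestedSA (Γ : Set) : ℕ → Set where
  nested₁ : FA Γ → NestedSA Γ 1
  nestedₙ : ∀ {n} → FA (NestedSA Γ (suc n)) → NestedSA Γ (2 + n)

module _ {Γ : Set} where

  NestedAccepts : ∀ {n} → NestedSA Γ n → Pred (Store Γ n) 0ℓ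
  NestedAccepts {suc zero}    (nested₁ M) [ as ]₁ = Accepts M as
  NestedAccepts {suc (suc n)} (nestedₙ M) [ ss ]ₙ =
    ∃[ Ns ] Accepts M Ns × Pointwise (NestedAccepts {suc n}) Ns (toList ss)

  infix 4 _NestedRecognizes_

  _NestedRecognizes_ : ∀ {n} → NestedSA Γ n → Pred (Store Γ n) 0ℓ → Set
  N NestedRecognizes S = ∀ s → NestedAccepts N s ⇔ s ∈ S

{-# OPTIONS --safe #-}

-- A list of stores (or letters) inside an n-store is evaluated as a function of
-- the values of the lists to its right at the enclosing levels. The result is a
-- Boolean, telling whether the n-store whose top is this list lies in pre*(S),
-- together with the set of states from which A accepts the word that starts with
-- this list. The only unknown is the table of Booleans for a top letter a and
-- the values x₁ , … , xₙ of the lists below it at levels 1 , … , n. Every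
-- operation expresses an entry by others: popₖ applies xₖ to xₖ₊₁ , … , xₙ; pushₖ
-- replaces xₖ by y xₖ and applies y to it, where y is the value of the top
-- (k - 1)-store; push₁ʷ replaces x₁ by the value of w on top of x₁. All value
-- spaces are finite, so adding entries from the empty table on stabilises. A
-- stable table covers pre*(S) by induction on the steps taken, and each iterate
-- is sound by a logical relation between values and actual lists. Thus pre*(S) is
-- the inverse image of a set under a compositional evaluation into finite sets,
-- and an automaton can guess the values of what remains to be read.
module Submission where

open import Data.Bool.Base using (Bool; true; false; T; _∨_; _∧_; if_then_else_)
open import Data.Bool.ListAction using (any)
open import Data.Bool.Properties using (T-∨; T-∧; T-≡) renaming (_≟_ to _≟ᵇ_)
open import Data.Empty using (⊥; ⊥-elim)
open import Data.Fin.Base using (Fin; zero; suc; funToFin; finToFun; combine)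
open import Data.Fin.Properties using (finToFun-funToFin; *↔×; +↔⊎; 2↔Bool) renaming (_≟_ to _≟ᶠ_; any? to anyᶠ?)
open import Data.Fin.Subset using (Subset; ∣_∣; _∪_; _⊆_) renaming (_∈_ to _∈ˢ_; ⊥ to ∅)
open import Data.Fin.Subset.Properties using (_∈?_; _⊂?_; ∉⊥; ∣p∣≤n; p⊂q⇒∣p∣<∣q∣; p⊆p∪q; q⊆p∪q; x∈p∪q⁻)
open import Data.List.Base using (List; []; _∷_; _++_; map; concatMap; foldr; replicate; filter; cartesianProduct; allFin)
open import Data.List.Membership.Propositional using (find; lose) renaming (_∈_ to _∈ˡ_)
open import Data.List.Membership.Propositional.Properties using (∈-map⁺; ∈-map⁻; ∈-filter⁺; ∈-filter⁻; ∈-cartesianProduct⁺; ∈-allFin)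
open import Data.List.NonEmpty.Base using (_∷_; toList)
open import Data.List.Properties using (++-assoc; ++-identityʳ; ∷-injective; foldr-++; foldr-map)
open import Data.List.Relation.Binary.Pointwise.Base using (Pointwise; []; _∷_)
open import Data.List.Relation.Unary.Any using (any?)
open import Data.List.Relation.Unary.Any.Properties using (any⁺; any⁻)
open import Data.Maybe.Base using (just; nothing)
import Data.Maybe.Base as Maybe
open import Data.Nat.Base using (ℕ; zero; suc; _+_; _*_; _^_; _∸_; _<_; _≤_)
open import Data.Nat.Induction using (<-wellFounded)
open import Data.Nat.Properties using (∸-monoʳ-<) renaming (_≟_ to _≟ℕ_)
open import Data.Product.Base using (∃-syntax; Σ-syntax; _×_; _,_; proj₁; proj₂)
open import Data.Product.Function.NonDependent.Propositional using (_×-↪_)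
open import Data.Product.Properties using (≡-dec)
open import Data.Sum.Base using (_⊎_; inj₁; inj₂)
open import Data.Sum.Function.Propositional using (_⊎-↪_)
open import Data.Unit.Base using (⊤; tt)
open import Data.Vec.Base using (lookup; tabulate)
open import Data.Vec.Properties using (lookup∘tabulate; tabulate∘lookup; tabulate-cong; []=⇒lookup; lookup⇒[]=)
open import Function.Base using (_∘_)
open import Function.Bundles using (_↔_; _⇔_; _↪_; mk↪; mk⇔; Equivalence; Inverse; RightInverse)
open import Function.Construct.Composition using (_↪-∘_; _⇔-∘_)
open import Function.Construct.Identity using (↪-id)
open import Function.Construct.Symmetry using (↔-sym)
open import Function.Properties.Inverse using (↔⇒↪)
open import Induction.WellFounded using (Acc; acc)
open import Level using (0ℓ)
open import Relation.Binary.Construct.Closure.ReflexiveTransitive using (Star; ε; _◅_)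
open import Relation.Binary.Definitions using (DecidableEquality)
open import Relation.Binary.PropositionalEquality
open import Relation.Nullary.Decidable using (Dec; yes; no; does; isYes; toWitness; fromWitness; map′; _×-dec_; T?)
open import Relation.Nullary.Negation using (contradiction)
open import Relation.Unary using (Pred; _∈_)
open import Defs

open RightInverse using (to; from; strictlyInverseʳ)

private variable
  A B : Set
  m n : ℕ

-- Finite sets and codes for functions between them

finite-≟ : A ↪ Fin n → DecidableEquality A
finite-≟ f x y = map′
  (λ eq → trans (sym (strictlyInverseʳ f x)) (trans (cong (from f) eq) (strictlyInverseʳ f y)))
  (cong (to f)) (to f x ≟ᶠ to f y)

×-finite : A ↪ Fin m → B ↪ Fin n → (A × B) ↪ Fin (m * n)
×-finite f g = ↔⇒↪ (↔-sym *↔×) ↪-∘ (f ×-↪ g)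

⊤-finite : ⊤ ↪ Fin 1
⊤-finite = mk↪ {to = λ _ → zero} {from = λ _ → tt} λ _ → refl

funToFin-cong : {f g : Fin m → Fin n} → f ≗ g → funToFin f ≡ funToFin g
funToFin-cong {zero}  f≗g = refl
funToFin-cong {suc m} f≗g = cong₂ combine (f≗g zero) (funToFin-cong (f≗g ∘ suc))

-- Function spaces between finite sets are coded, since functions themselves
-- have no decidable propositional equality; encode only has to respect
-- pointwise equality.
module Coded (f : A ↪ Fin m) (g : B ↪ Fin n) where

  abstract
    encode : (A → B) → Fin (n ^ m)
    encode h = funToFin (to g ∘ h ∘ from f)

    decode : Fin (n ^ m) → A → B
    decode i = from g ∘ finToFun i ∘ to f

    decode-encode : ∀ h a → decode (encode h) a ≡ h a
    decode-encode h a = begin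
      from g (finToFun (encode h) (to f a))  ≡⟨ cong (from g) (finToFun-funToFin (to g ∘ h ∘ from f) (to f a)) ⟩
      from g (to g (h (from f (to f a))))    ≡⟨ strictlyInverseʳ g _ ⟩
      h (from f (to f a))                    ≡⟨ cong h (strictlyInverseʳ f a) ⟩
      h a                                    ∎
      where open ≡-Reasoning

    encode-cong : ∀ {h k} → h ≗ k → encode h ≡ encode k
    encode-cong h≗k = funToFin-cong (λ i → cong (to g) (h≗k (from f i)))

Subset-finite : ∀ n → Subset n ↪ Fin (2 ^ n)
Subset-finite n = mk↪ {to = funToFin ∘ (from b ∘_) ∘ lookup} {from = λ i → tabulate (to b ∘ finToFun i)} λ { {p} refl →
  trans (tabulate-cong (λ i → trans (cong (to b) (finToFun-funToFin _ i)) (strictlyInverseˡ _))) (tabulate∘lookup p) }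
  where
  open Inverse 2↔Bool using (strictlyInverseˡ)
  b : Fin 2 ↪ Bool
  b = ↔⇒↪ 2↔Bool

-- Iteration of an inflationary map on subsets

module _ (f : Subset n → Subset n) where

  iterate : ℕ → Subset n
  iterate zero    = ∅
  iterate (suc k) = f (iterate k)

  -- While the inclusion is strict the size grows, and it is bounded by `n`. Once it is not strict,
  -- no element of `f (iterate k)` can lie outside `iterate k`.
  iterate-stabilises : (∀ p → p ⊆ f p) → ∃[ k ] f (iterate k) ⊆ iterate k
  iterate-stabilises inflationary = search 0 (<-wellFounded _)
    where
    search : ∀ k → Acc _<_ (n ∸ ∣ iterate k ∣) → ∃[ k ] f (iterate k) ⊆ iterate k
    search k (acc rec) with iterate k ⊂? f (iterate k)
    ... | yes p⊂fp = search (suc k) (rec (∸-monoʳ-< (p⊂q⇒∣p∣<∣q∣ p⊂fp) (∣p∣≤n (f (iterate k)))))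
    ... | no p⊄fp = k , λ {x} x∈fp → case-∈ x∈fp (x ∈? iterate k)
      where
      case-∈ : ∀ {x} → x ∈ˢ f (iterate k) → Dec (x ∈ˢ iterate k) → x ∈ˢ iterate k
      case-∈ _    (yes x∈p) = x∈p
      case-∈ x∈fp (no  x∉p) = ⊥-elim (p⊄fp (inflationary (iterate k) , _ , x∈fp , x∉p))

-- Unique readability of the words of stores

module _ {Γ : Set} where

  inner : ∀ {j} → Store Γ (suc j) → List (Γ′ Γ)
  inner {zero}  [ as ]₁ = map letter as
  inner {suc j} [ ss ]ₙ = concatMap word (toList ss)

  body : ∀ {j} → Store Γ (suc j) → List (Γ′ Γ)
  body s = inner s ++ ⟧ ∷ []

  word-body : ∀ {j} (s : Store Γ (suc j)) → word s ≡ ⟦ ∷ body s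
  word-body {zero}  [ as ]₁ = refl
  word-body {suc j} [ ss ]ₙ = refl

  words-∷ : ∀ {j} (s : Store Γ (suc j)) (ss : List (Store Γ (suc j))) (u : List (Γ′ Γ)) →
    ((word s ++ concatMap word ss) ++ ⟧ ∷ []) ++ u ≡ word s ++ (concatMap word ss ++ ⟧ ∷ []) ++ u
  words-∷ s ss u = trans (cong (_++ u) (++-assoc (word s) _ _)) (++-assoc (word s) _ u)

  letters-injective : ∀ as bs {u v : List (Γ′ Γ)} →
    (map letter as ++ ⟧ ∷ []) ++ u ≡ (map letter bs ++ ⟧ ∷ []) ++ v → as ≡ bs × u ≡ v
  letters-injective []       []       refl = refl , refl
  letters-injective (a ∷ as) (b ∷ bs) eq with ∷-injective eq
  ... | refl , eq′ with letters-injective as bs eq′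
  ... | refl , u≡v = refl , u≡v

  mutual
    -- The words of stores form a prefix code: the matching closing bracket shows where a store
    -- ends. The remainders `u` and `v` let the induction split off one store after another.
    word-injective : ∀ {j} (s t : Store Γ (suc j)) {u v} → word s ++ u ≡ word t ++ v → s ≡ t × u ≡ v
    word-injective {zero} [ as ]₁ [ bs ]₁ eq with letters-injective as bs (proj₂ (∷-injective eq))
    ... | refl , u≡v = refl , u≡v
    word-injective {suc j} [ s ∷ ss ]ₙ [ t ∷ ts ]ₙ eq with words-injective (s ∷ ss) (t ∷ ts) (proj₂ (∷-injective eq))
    ... | refl , u≡v = refl , u≡v

    words-injective : ∀ {j} (ss ts : List (Store Γ (suc j))) {u v} →
      (concatMap word ss ++ ⟧ ∷ []) ++ u ≡ (concatMap word ts ++ ⟧ ∷ []) ++ v → ss ≡ ts × u ≡ v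
    words-injective [] [] refl = refl , refl
    -- A nonempty list starts with an opening bracket, while an empty one is closed at once.
    words-injective [] (t ∷ ts) eq rewrite word-body t with () ← eq
    words-injective (s ∷ ss) [] eq rewrite word-body s with () ← eq
    words-injective (s ∷ ss) (t ∷ ts) {u} {v} eq
      with word-injective s t (trans (sym (words-∷ s ss u)) (trans eq (words-∷ t ts v)))
    ... | refl , eq′ with words-injective ss ts eq′
    ... | refl , u≡v = refl , u≡v

-- Sets of states read backwards

module Backward {A : Set} (_≟_ : DecidableEquality A) (M : FA A) where
  open FA M

  abstract
    pre? : ∀ a X p → Dec (∃[ q ] (p , a , q) ∈ˡ transitions × q ∈ˢ X)
    pre? a X p = anyᶠ? λ q →
      any? (≡-dec _≟ᶠ_ (≡-dec _≟_ _≟ᶠ_) (p , a , q)) transitions ×-dec (q ∈? X)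

    pre : A → Subset size → Subset size
    pre a X = tabulate (does ∘ pre? a X)

    ∈-pre⁻ : ∀ a X p → p ∈ˢ pre a X → ∃[ q ] (p , a , q) ∈ˡ transitions × q ∈ˢ X
    ∈-pre⁻ a X p p∈ with pre? a X p | trans (sym (lookup∘tabulate (does ∘ pre? a X) p)) ([]=⇒lookup p∈)
    ... | yes q | _ = q

    ∈-pre⁺ : ∀ a X p → ∃[ q ] (p , a , q) ∈ˡ transitions × q ∈ˢ X → p ∈ˢ pre a X
    ∈-pre⁺ a X p q with pre? a X p in eq
    ... | yes _ = lookup⇒[]= p _ (trans (lookup∘tabulate (does ∘ pre? a X) p) (cong does eq))
    ... | no ¬q = contradiction q ¬q

  -- The subset construction from the right: the set for a list is computed from the set for its
  -- tail, just as the value of a list will be.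
  back : List A → Subset size → Subset size
  back w X = foldr pre X w

  accepting : List A → Subset size → Bool
  accepting w X = lookup (back w X) start

  ∈-back⁻ : ∀ w X p → p ∈ˢ back w X → ∃[ r ] r ∈ˢ X × Run M p w r
  ∈-back⁻ []      X p p∈ = p , p∈ , []
  ∈-back⁻ (a ∷ w) X p p∈ with ∈-pre⁻ a _ p p∈
  ... | q , tr , q∈ with ∈-back⁻ w X q q∈
  ... | r , r∈ , run = r , r∈ , tr ∷ run

  ∈-back⁺ : ∀ w X p → ∃[ r ] r ∈ˢ X × Run M p w r → p ∈ˢ back w X
  ∈-back⁺ []      X p (_ , p∈ , []) = p∈
  ∈-back⁺ (a ∷ w) X p (r , r∈ , tr ∷ run) = ∈-pre⁺ a _ p (_ , tr , ∈-back⁺ w X _ (r , r∈ , run))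

  accepting⁻ : ∀ w → T (accepting w final) → Accepts M w
  accepting⁻ w t with lookup (back w final) start in eq
  ... | true = ∈-back⁻ w final start (lookup⇒[]= start _ eq)

  accepting⁺ : ∀ w → Accepts M w → T (accepting w final)
  accepting⁺ w accepted rewrite []=⇒lookup (∈-back⁺ w final start accepted) = tt

-- Evaluation of stores in finite algebras

-- One finite carrier per level, with lists folded from the right. A `node` needs a value for the
-- empty list although no store above level 1 is empty: it is the value of the tail of a singleton.
data Algebra (Γ : Set) : ℕ → ℕ → Set where
  base : ∀ {N} → Fin N → (Γ → Fin N → Fin N) → Algebra Γ 0 N
  node : ∀ {j M N} → Fin N → (Fin M → Fin N → Fin N) → Algebra Γ j M → Algebra Γ (suc j) N

eval : ∀ {Γ j N} → Algebra Γ j N → Store Γ (suc j) → Fin N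
eval (base e act)   [ as ]₁ = foldr act e as
eval (node e act A) [ ss ]ₙ = foldr (λ s → act (eval A s)) e (toList ss)

Γ′-finite : ∀ {Γ m} → Γ ↪ Fin m → Γ′ Γ ↪ Fin (2 + m)
Γ′-finite {Γ} {m} f = mk↪ {to = enc} {from = dec} λ { {x} refl → dec-enc x }
  where
  enc : Γ′ Γ → Fin (2 + m)
  enc ⟦          = zero
  enc ⟧          = suc zero
  enc (letter a) = suc (suc (to f a))
  dec : Fin (2 + m) → Γ′ Γ
  dec zero          = ⟦
  dec (suc zero)    = ⟧
  dec (suc (suc i)) = letter (from f i)
  dec-enc : ∀ x → dec (enc x) ≡ x
  dec-enc ⟦          = refl
  dec-enc ⟧          = refl
  dec-enc (letter a) = cong letter (strictlyInverseʳ f a)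

-- Frames and the values of lists in them

module Values {Γ : Set} {m : ℕ} (Γ-finite : Γ ↪ Fin m) (A : FA (Γ′ Γ)) where
  open FA A using (size; start; final)
  open Backward (finite-≟ (Γ′-finite Γ-finite)) A public

  R : Set
  R = Bool × Subset size

  R-finite : R ↪ Fin (2 * 2 ^ size)
  R-finite = ×-finite (↔⇒↪ (↔-sym 2↔Bool)) (Subset-finite size)

  -- The surroundings of an open list: K are the possible values of the lists to
  -- its right at the enclosing levels, opens are the brackets before its own
  -- opening bracket, and future κ are the states from which A accepts what
  -- follows its closing bracket.
  record Frame : Set₁ where
    field
      {K}    : Set
      {card} : ℕ
      finite : K ↪ Fin card
      future : K → Subset size
      opens  : List (Γ′ Γ)

  open Frame

  -- `2 * 2 ^ size` counts `R`, so these are codes of functions from `K L` to `R`.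
  D : Frame → Set
  D L = Fin ((2 * 2 ^ size) ^ card L)

  mk : ∀ L → (K L → R) → D L
  mk L = Coded.encode (finite L) R-finite

  run : ∀ L → D L → K L → R
  run L = Coded.decode (finite L) R-finite

  run-mk : ∀ L f κ → run L (mk L f) κ ≡ f κ
  run-mk L = Coded.decode-encode (finite L) R-finite

  mk-cong : ∀ L {f g} → f ≗ g → mk L f ≡ mk L g
  mk-cong L = Coded.encode-cong (finite L) R-finite

  next : Frame → Frame
  next L = record
    { K      = D L × K L
    ; finite = ×-finite (↪-id _) (finite L)
    -- After an inner list closes, the rest of the list at the level of `L` is read, and the value
    -- of that rest already records the states from there.
    ; future = λ xκ → proj₂ (run L (proj₁ xκ) (proj₂ xκ))
    ; opens  = opens L ++ ⟦ ∷ []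
    }

  -- One step further than the frame of the 1-store, so that `K (bot j L)` also contains the value
  -- of the letters below the top one.
  bot : ℕ → Frame → Frame
  bot zero    L = next L
  bot (suc j) L = bot j (next L)

  -- Tables and the effect of the operations on values

  Table : ℕ → Frame → Set
  Table j L = Γ → K (bot j L) → Bool

  -- Both out and repl address the values at and outside the level of L, in a
  -- tuple that lists the values at all levels down to the letters.
  out : ∀ j L → K (bot j L) → K (next L)
  out zero    L c = c
  out (suc j) L c = proj₂ (out j (next L) c)

  repl : ∀ j L → K (bot j L) → K L → K (bot j L)
  repl zero    L (x , _) κ = x , κ
  repl (suc j) L c       κ = repl j (next L) c (proj₁ (out (suc j) L c) , κ)

  -- Without a top letter no step is possible, so the bit only tests whether `A` accepts the word of
  -- the completed store.
  empty₁ : ∀ L → D L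
  empty₁ L = mk L λ κ → accepting (opens L ++ ⟦ ∷ ⟧ ∷ []) (future L κ) , pre ⟧ (future L κ)

  cons₁ : ∀ L → Table 0 L → Γ → D L → D L
  cons₁ L t a x = mk L λ κ → t a (x , κ) , pre (letter a) (proj₂ (run L x κ))

  -- An empty list arises only as the tail of a singleton. Popping down to it is undefined, hence
  -- `false`.
  emptyₙ : ∀ L → D L
  emptyₙ L = mk L λ κ → false , pre ⟧ (future L κ)

  -- The list and its first store belong to one configuration, so the bit passes through; the states
  -- move back over the bracket that opens the first store.
  consₙ : ∀ L → D (next L) → D L → D L
  consₙ L y x = mk L λ κ → proj₁ (run (next L) y (x , κ)) , pre ⟦ (proj₂ (run (next L) y (x , κ)))

  algebra : ∀ j L → Table j L → Algebra Γ j ((2 * 2 ^ size) ^ card L)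
  algebra zero    L t = base (empty₁ L) (cons₁ L t)
  algebra (suc j) L t = node (emptyₙ L) (consₙ L) (algebra j (next L) t)

  val : ∀ j L → Table j L → Store Γ (suc j) → D L
  val j L t = eval (algebra j L t)

  vals₁ : ∀ L → Table 0 L → List Γ → D L
  vals₁ L t = foldr (cons₁ L t) (empty₁ L)

  vals : ∀ j L → Table (suc j) L → List (Store Γ (suc j)) → D L
  vals j L t = foldr (λ s → consₙ L (val j (next L) t s)) (emptyₙ L)

  -- The body of a store at level `suc j` begins like this. Bodies lack the outermost bracket, so
  -- the whole word starts with `brackets (suc j) a`.
  brackets : ℕ → Γ → List (Γ′ Γ)
  brackets j a = replicate j ⟦ ++ letter a ∷ []

  -- Only the top letter and the values below it are at hand, not the store. Its value is recovered
  -- as a function, by asking the table about the same lists in all other surroundings `κ`.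
  topVal : ∀ j L → Table j L → Γ → K (bot j L) → D L
  topVal j L t a c = mk L λ κ →
    t a (repl j L c κ) , back (brackets j a) (future (bot j L) (repl j L c κ))

  push₁-bit : ∀ j L → Table j L → List Γ → K (bot j L) → Bool
  -- The tuple omits the top letter, so `w` goes directly on `x`.
  push₁-bit zero    L t w (x , κ) = proj₁ (run L (foldr (cons₁ L t) x w) κ)
  push₁-bit (suc j) L t w c       = push₁-bit j (next L) t w c

  pushₖ-here : ∀ j L → Table (suc j) L → Γ → K (bot (suc j) L) → Bool
  pushₖ-here j L t a c = proj₁ (run (next L) y (consₙ L y (proj₁ xκ) , proj₂ xκ))
    where
    xκ = out (suc j) L c
    y = topVal j (next L) t a c

  pushₖ-bit : ∀ j L → Table j L → ℕ → Γ → K (bot j L) → Bool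
  pushₖ-bit zero    L t k a c = false
  pushₖ-bit (suc j) L t k a c =
    if does (k ≟ℕ 2 + j) then pushₖ-here j L t a c else pushₖ-bit j (next L) t k a c

  popₖ-bit : ∀ j L → ℕ → K (bot j L) → Bool
  popₖ-bit zero    L k c = false
  popₖ-bit (suc j) L k c =
    if does (k ≟ℕ 2 + j)
      then proj₁ (run L (proj₁ (out (suc j) L c)) (proj₂ (out (suc j) L c)))
      else popₖ-bit j (next L) k c

  op-bit : ∀ {n} → Op Γ n → ∀ j L → Table j L → Γ → K (bot j L) → Bool
  op-bit (push₁-op w)    j L t a = push₁-bit j L t w
  op-bit (push-op k _ _) j L t a = pushₖ-bit j L t k a
  op-bit (pop-op  k _ _) j L t a = popₖ-bit j L k

  -- Exact values of stores and completeness of the operations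

  accepting-++ : ∀ u v X → accepting (u ++ v) X ≡ accepting u (back v X)
  accepting-++ u v X = cong (λ Y → lookup Y start) (foldr-++ pre X u v)

  back-++ : ∀ u v X → back (u ++ v) X ≡ back u (back v X)
  back-++ u v X = foldr-++ pre X u v

  accepting-next : ∀ {j} L (s : Store Γ (suc j)) (ss : List (Store Γ (suc j))) X →
    accepting (opens (next L) ++ word s) (back (concatMap word ss ++ ⟧ ∷ []) X) ≡
    accepting (opens L ++ word [ s ∷ ss ]ₙ) X
  accepting-next L s ss X = trans (sym (accepting-++ (opens (next L) ++ word s) _ X)) (cong (λ w → accepting w X) eq)
    where
    eq : (opens (next L) ++ word s) ++ concatMap word ss ++ ⟧ ∷ [] ≡ opens L ++ word [ s ∷ ss ]ₙ
    eq = begin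
      ((opens L ++ ⟦ ∷ []) ++ word s) ++ concatMap word ss ++ ⟧ ∷ []  ≡⟨ cong (_++ _) (++-assoc (opens L) _ _) ⟩
      (opens L ++ ⟦ ∷ word s) ++ concatMap word ss ++ ⟧ ∷ []          ≡⟨ ++-assoc (opens L) _ _ ⟩
      opens L ++ ⟦ ∷ word s ++ concatMap word ss ++ ⟧ ∷ []            ≡⟨ cong (λ w → opens L ++ ⟦ ∷ w) (++-assoc (word s) _ _) ⟨
      opens L ++ word [ s ∷ ss ]ₙ                                     ∎
      where open ≡-Reasoning

  future-vals₁ : ∀ L t as κ → proj₂ (run L (vals₁ L t as) κ) ≡ back (map letter as ++ ⟧ ∷ []) (future L κ)
  future-vals₁ L t []       κ = cong proj₂ (run-mk L _ κ)
  future-vals₁ L t (a ∷ as) κ = trans (cong proj₂ (run-mk L _ κ)) (cong (pre (letter a)) (future-vals₁ L t as κ))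

  future-consₙ : ∀ j L y x (s : Store Γ (suc j)) ss κ →
    proj₂ (run (next L) y (x , κ)) ≡ back (body s) (future (next L) (x , κ)) →
    proj₂ (run L x κ) ≡ back (concatMap word ss ++ ⟧ ∷ []) (future L κ) →
    proj₂ (run L (consₙ L y x) κ) ≡ back (concatMap word (s ∷ ss) ++ ⟧ ∷ []) (future L κ)
  future-consₙ j L y x s ss κ eqy eqx = begin
    proj₂ (run L (consₙ L y x) κ)                                            ≡⟨ cong proj₂ (run-mk L _ κ) ⟩
    pre ⟦ (proj₂ (run (next L) y (x , κ)))                                   ≡⟨ cong (pre ⟦) eqy ⟩
    back (⟦ ∷ body s) (future (next L) (x , κ))                              ≡⟨ cong₂ back (sym (word-body s)) eqx ⟩
    back (word s) (back (concatMap word ss ++ ⟧ ∷ []) (future L κ))          ≡⟨ back-++ (word s) _ _ ⟨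
    back (word s ++ concatMap word ss ++ ⟧ ∷ []) (future L κ)                ≡⟨ cong (λ w → back w (future L κ)) (++-assoc (word s) _ _) ⟨
    back (concatMap word (s ∷ ss) ++ ⟧ ∷ []) (future L κ)                    ∎
    where open ≡-Reasoning

  mutual
    -- The sets of states never consult the table, so they are those of a backward reading by `A`,
    -- whatever `t` is.
    future-val : ∀ j L t s κ → proj₂ (run L (val j L t s) κ) ≡ back (body s) (future L κ)
    future-val zero    L t [ as ]₁     κ = future-vals₁ L t as κ
    future-val (suc j) L t [ s ∷ ss ]ₙ κ = future-vals j L t (s ∷ ss) κ

    future-vals : ∀ j L t ss κ →
      proj₂ (run L (vals j L t ss) κ) ≡ back (concatMap word ss ++ ⟧ ∷ []) (future L κ)
    future-vals j L t []       κ = cong proj₂ (run-mk L _ κ)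
    future-vals j L t (s ∷ ss) κ = future-consₙ j L _ _ s ss κ
      (future-val j (next L) t s _) (future-vals j L t ss κ)

  ctx : ∀ j L → Table j L → Store Γ (suc j) → K L → K (bot j L)
  -- There is no top letter here; `empty₁ L` is only a filler.
  ctx zero    L t [ []     ]₁ κ = empty₁ L , κ
  ctx zero    L t [ a ∷ as ]₁ κ = vals₁ L t as , κ
  ctx (suc j) L t [ s ∷ ss ]ₙ κ = ctx j (next L) t s (vals j L t ss , κ)

  out-ctx : ∀ j L t s κ → proj₂ (out j L (ctx j L t s κ)) ≡ κ
  out-ctx zero    L t [ []     ]₁ κ = refl
  out-ctx zero    L t [ a ∷ as ]₁ κ = refl
  out-ctx (suc j) L t [ s ∷ ss ]ₙ κ = cong proj₂ (out-ctx j (next L) t s _)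

  repl-ctx : ∀ j L t s κ κ′ → repl j L (ctx j L t s κ) κ′ ≡ ctx j L t s κ′
  repl-ctx zero    L t [ []     ]₁ κ κ′ = refl
  repl-ctx zero    L t [ a ∷ as ]₁ κ κ′ = refl
  repl-ctx (suc j) L t [ s ∷ ss ]ₙ κ κ′ = trans
    (cong (λ xκ → repl j (next L) (ctx j (next L) t s (vals j L t ss , κ)) (proj₁ xκ , κ′)) (out-ctx j (next L) t s _))
    (repl-ctx j (next L) t s _ _)

  -- On the way down to the top letter every level passes the bit on and adds one opening bracket;
  -- at level 1, `cons₁` looks up the table.
  run-top : ∀ j L t s κ {a} → top₁ s ≡ just a →
    run L (val j L t s) κ ≡ (t a (ctx j L t s κ) , back (brackets j a) (future (bot j L) (ctx j L t s κ)))
  run-top zero    L t [ a ∷ as ]₁ κ refl = run-mk L _ κ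
  run-top (suc j) L t [ s ∷ ss ]ₙ κ top  = trans (run-mk L _ κ)
    (cong (λ r → proj₁ r , pre ⟦ (proj₂ r)) (run-top j (next L) t s _ top))

  -- `run L` followed by `mk L` is not known to be the identity on all codes, as embeddings into
  -- `Fin` need not be onto. Values of stores are codes made by `mk`, which is enough.
  mk-run-val : ∀ j L t s → mk L (run L (val j L t s)) ≡ val j L t s
  mk-run-val zero    L t [ []     ]₁ = mk-cong L (run-mk L _)
  mk-run-val zero    L t [ a ∷ as ]₁ = mk-cong L (run-mk L _)
  mk-run-val (suc j) L t [ s ∷ ss ]ₙ = mk-cong L (run-mk L _)

  topVal-ctx : ∀ j L t s κ {a} → top₁ s ≡ just a → topVal j L t a (ctx j L t s κ) ≡ val j L t s
  topVal-ctx j L t s κ {a} top = trans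
    (mk-cong L λ κ′ → trans
      (cong (λ c → t a c , back (brackets j a) (future (bot j L) c)) (repl-ctx j L t s κ κ′))
      (sym (run-top j L t s κ′ top)))
    (mk-run-val j L t s)

  -- At exact tuples the operations are computed exactly for an arbitrary table, since both sides
  -- evaluate with the same `t`. Stability enters only when a bit of `step` is put back into the
  -- table.
  pop-complete : ∀ j L t k s {s′} κ → popₖ k s ≡ just s′ →
    popₖ-bit j L k (ctx j L t s κ) ≡ proj₁ (run L (val j L t s′) κ)
  pop-complete (suc j) L t k [ s ∷ ss ]ₙ κ eq with does (k ≟ℕ 2 + j)
  pop-complete (suc j) L t k [ s ∷ s′ ∷ ss ]ₙ κ refl | true =
    cong (λ xκ → proj₁ (run L (proj₁ xκ) (proj₂ xκ))) (out-ctx j (next L) t s _)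
  ... | false with popₖ k s in eqs | eq
  ... | just s₁ | refl = trans (pop-complete j (next L) t k s _ eqs) (sym (cong proj₁ (run-mk L _ κ)))

  push-complete : ∀ j L t k s {s′} κ {a} → top₁ s ≡ just a → pushₖ k s ≡ just s′ →
    pushₖ-bit j L t k a (ctx j L t s κ) ≡ proj₁ (run L (val j L t s′) κ)
  push-complete (suc j) L t k [ s ∷ ss ]ₙ κ top eq with does (k ≟ℕ 2 + j)
  push-complete (suc j) L t k [ s ∷ ss ]ₙ κ top refl | true = trans
    (cong₂ (λ y xκ → proj₁ (run (next L) y (consₙ L y (proj₁ xκ) , proj₂ xκ)))
      (topVal-ctx j (next L) t s _ top) (out-ctx j (next L) t s _))
    (sym (cong proj₁ (run-mk L _ κ)))
  ... | false with pushₖ k s in eqs | eq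
  ... | just s₁ | refl = trans (push-complete j (next L) t k s _ top eqs) (sym (cong proj₁ (run-mk L _ κ)))

  push₁-complete : ∀ j L t w s {s′} κ → push₁ w s ≡ just s′ →
    push₁-bit j L t w (ctx j L t s κ) ≡ proj₁ (run L (val j L t s′) κ)
  push₁-complete zero    L t w [ a ∷ as ]₁ κ refl =
    cong (λ x → proj₁ (run L x κ)) (sym (foldr-++ (cons₁ L t) (empty₁ L) w as))
  push₁-complete (suc j) L t w [ s ∷ ss ]ₙ κ eq with push₁ w s in eqs | eq
  ... | just s₁ | refl = trans (push₁-complete j (next L) t w s _ eqs) (sym (cong proj₁ (run-mk L _ κ)))

  -- The descent ends in `empty₁`, whose bit is acceptance.
  run-no-top : ∀ j L t s κ → top₁ s ≡ nothing →
    proj₁ (run L (val j L t s) κ) ≡ accepting (opens L ++ word s) (future L κ)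
  run-no-top zero    L t [ []     ]₁ κ top = cong proj₁ (run-mk L _ κ)
  run-no-top (suc j) L t [ s ∷ ss ]ₙ κ top = begin
    proj₁ (run L (val (suc j) L t [ s ∷ ss ]ₙ) κ)           ≡⟨ cong proj₁ (run-mk L _ κ) ⟩
    proj₁ (run (next L) (val j (next L) t s) (vals j L t ss , κ)) ≡⟨ run-no-top j (next L) t s _ top ⟩
    accepting (opens (next L) ++ word s) (proj₂ (run L (vals j L t ss) κ)) ≡⟨ cong (accepting (opens (next L) ++ word s)) (future-vals j L t ss κ) ⟩
    accepting (opens (next L) ++ word s) (back (concatMap word ss ++ ⟧ ∷ []) (future L κ)) ≡⟨ accepting-next L s ss _ ⟩
    accepting (opens L ++ word [ s ∷ ss ]ₙ) (future L κ) ∎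
    where open ≡-Reasoning

  -- Soundness through a logical relation

  -- The logical relation at one level: e ∈ E are actual lists to the right at the
  -- enclosing levels, φ e s says that s completed by e lies in pre*(S), and κ ⊲ e
  -- that the values κ do not claim too much about e.
  record Model (j : ℕ) (L : Frame) : Set₁ where
    infix 4 _⊲_
    field
      E        : Set
      φ        : E → Store Γ (suc j) → Set
      _⊲_      : K L → E → Set
      accepted : ∀ {κ e} s → κ ⊲ e → T (accepting (opens L ++ word s) (future L κ)) → φ e s

  open Model

  φ-list : ∀ {j L} (M : Model (suc j) L) → E M → List (Store Γ (suc j)) → Set
  φ-list M e []       = ⊥
  φ-list M e (s ∷ ss) = φ M e [ s ∷ ss ]ₙ

  -- As usual for functions, related arguments must give related results. The bit is only an
  -- implication, because an unfinished table may miss stores; the states do not depend on the table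
  -- and are exact.
  Describes : ∀ {j L} (M : Model j L) → D L → (E M → Set) → List (Γ′ Γ) → Set
  Describes {j} {L} M x P u = ∀ κ e → _⊲_ M κ e →
    (T (proj₁ (run L x κ)) → P e) × proj₂ (run L x κ) ≡ back u (future L κ)

  Describes₁ : ∀ {L} → Model 0 L → D L → List Γ → Set
  Describes₁ M x as = Describes M x (λ e → φ M e [ as ]₁) (map letter as ++ ⟧ ∷ [])

  Describesₙ : ∀ {j L} → Model (suc j) L → D L → List (Store Γ (suc j)) → Set
  Describesₙ M x ss = Describes M x (λ e → φ-list M e ss) (concatMap word ss ++ ⟧ ∷ [])

  nextM : ∀ {j L} → Model (suc j) L → Model j (next L)
  nextM {j} {L} M = record
    { E        = List (Store Γ (suc j)) × E M
    ; φ        = λ sse s → φ M (proj₂ sse) [ s ∷ proj₁ sse ]ₙ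
    ; _⊲_      = λ xκ sse → Describesₙ M (proj₁ xκ) (proj₁ sse) × _⊲_ M (proj₂ xκ) (proj₂ sse)
    ; accepted = λ {xκ} {sse} s x⊲ bit → accepted M [ s ∷ proj₁ sse ]ₙ (proj₂ x⊲)
        (subst T (trans (cong (accepting (opens (next L) ++ word s)) (proj₂ (proj₁ x⊲ (proj₂ xκ) (proj₂ sse) (proj₂ x⊲))))
                        (accepting-next L s (proj₁ sse) (future L (proj₂ xκ)))) bit)
    }

  -- The relation at all levels at once. It is not restricted to tuples of the form `ctx`, since an
  -- entry must be sound for whatever values describe the lists below the top letter.
  Represents : ∀ j L (M : Model j L) → K (bot j L) → Store Γ (suc j) → E M → Set
  Represents zero    L M c [ []     ]₁ e = ⊥
  Represents zero    L M c [ a ∷ as ]₁ e = Describes₁ M (proj₁ c) as × _⊲_ M (proj₂ c) e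
  Represents (suc j) L M c [ s ∷ ss ]ₙ e = Represents j (next L) (nextM M) c s (ss , e)

  Represents-out : ∀ j L M c s e → Represents j L M c s e → _⊲_ M (proj₂ (out j L c)) e
  Represents-out zero    L M c [ a ∷ as ]₁ e r = proj₂ r
  Represents-out (suc j) L M c [ s ∷ ss ]ₙ e r = proj₂ (Represents-out j (next L) (nextM M) c s (ss , e) r)

  Represents-repl : ∀ j L M c s e κ e′ → Represents j L M c s e → _⊲_ M κ e′ →
    Represents j L M (repl j L c κ) s e′
  Represents-repl zero    L M c [ a ∷ as ]₁ e κ e′ r κ⊲ = proj₁ r , κ⊲
  Represents-repl (suc j) L M c [ s ∷ ss ]ₙ e κ e′ r κ⊲ =
    Represents-repl j (next L) (nextM M) c s (ss , e) _ (ss , e′) r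
      (proj₁ (Represents-out j (next L) (nextM M) c s (ss , e) r) , κ⊲)

  Represents-future : ∀ j L M c s e {a} → Represents j L M c s e → top₁ s ≡ just a →
    back (brackets j a) (future (bot j L) c) ≡ back (body s) (future L (proj₂ (out j L c)))
  Represents-future zero    L M c [ a ∷ as ]₁ e r refl = cong (pre (letter a)) (proj₂ (proj₁ r (proj₂ c) e (proj₂ r)))
  Represents-future (suc j) L M c [ s ∷ ss ]ₙ e {a} r top = begin
    pre ⟦ (back (brackets j a) (future (bot j (next L)) c))
      ≡⟨ cong (pre ⟦) (Represents-future j (next L) (nextM M) c s (ss , e) r top) ⟩
    back (⟦ ∷ body s) (proj₂ (run L (proj₁ xκ) (proj₂ xκ)))
      ≡⟨ cong₂ back (sym (word-body s)) (proj₂ (proj₁ xκ⊲ (proj₂ xκ) e (proj₂ xκ⊲))) ⟩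
    back (word s) (back (concatMap word ss ++ ⟧ ∷ []) (future L (proj₂ xκ)))
      ≡⟨ back-++ (word s) _ _ ⟨
    back (word s ++ concatMap word ss ++ ⟧ ∷ []) (future L (proj₂ xκ))
      ≡⟨ cong (λ w → back w (future L (proj₂ xκ))) (++-assoc (word s) _ _) ⟨
    back (concatMap word (s ∷ ss) ++ ⟧ ∷ []) (future L (proj₂ xκ)) ∎
    where
    open ≡-Reasoning
    xκ = out (suc j) L c
    xκ⊲ = Represents-out j (next L) (nextM M) c s (ss , e) r

  Sound : ∀ j L → Model j L → Table j L → Set
  Sound j L M t = ∀ {a c} s e → top₁ s ≡ just a → Represents j L M c s e → T (t a c) → φ M e s

  Sound-next : ∀ {j L M t} → Sound (suc j) L M t → Sound j (next L) (nextM M) t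
  Sound-next sound s (ss , e) = sound [ s ∷ ss ]ₙ e

  cons₁-sound : ∀ {L M t} → Sound 0 L M t → ∀ a {x as} → Describes₁ M x as → Describes₁ M (cons₁ L t a x) (a ∷ as)
  cons₁-sound {L} sound a {x} {as} x-as κ e κ⊲ =
    (λ bit → sound [ a ∷ as ]₁ e refl (x-as , κ⊲) (subst T (cong proj₁ (run-mk L _ κ)) bit)) ,
    trans (cong proj₂ (run-mk L _ κ)) (cong (pre (letter a)) (proj₂ (x-as κ e κ⊲)))

  foldr-cons₁-sound : ∀ {L M t} → Sound 0 L M t → ∀ w {x as} → Describes₁ M x as →
    Describes₁ M (foldr (cons₁ L t) x w) (w ++ as)
  foldr-cons₁-sound sound []      x-as = x-as
  foldr-cons₁-sound sound (a ∷ w) x-as = cons₁-sound sound a (foldr-cons₁-sound sound w x-as)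

  empty₁-sound : ∀ {L} (M : Model 0 L) → Describes₁ M (empty₁ L) []
  empty₁-sound {L} M κ e κ⊲ =
    (λ bit → accepted M [ [] ]₁ κ⊲ (subst T (cong proj₁ (run-mk L _ κ)) bit)) ,
    cong proj₂ (run-mk L _ κ)

  emptyₙ-sound : ∀ {j L} (M : Model (suc j) L) → Describesₙ M (emptyₙ L) []
  emptyₙ-sound {j} {L} M κ e κ⊲ = subst T (cong proj₁ (run-mk L _ κ)) , cong proj₂ (run-mk L _ κ)

  consₙ-sound : ∀ {j L} {M : Model (suc j) L} {y x} s ss → Describes (nextM M) y (λ e → φ (nextM M) e s) (body s) →
    Describesₙ M x ss → Describesₙ M (consₙ L y x) (s ∷ ss)
  consₙ-sound {j} {L} {M} {y} {x} s ss y-s x-ss κ e κ⊲ =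
    (λ bit → proj₁ here (subst T (cong proj₁ (run-mk L _ κ)) bit)) ,
    future-consₙ j L y x s ss κ (proj₂ here) (proj₂ (x-ss κ e κ⊲))
    where
    here = y-s (x , κ) (ss , e) (x-ss , κ⊲)

  mutual
    val-sound : ∀ {j L M t} → Sound j L M t → ∀ s → Describes M (val j L t s) (λ e → φ M e s) (body s)
    val-sound {zero}  {L} {M} {t} sound [ as ]₁ = subst (Describes₁ M (vals₁ L t as)) (++-identityʳ as)
      (foldr-cons₁-sound {t = t} sound as (empty₁-sound M))
    val-sound {suc j} sound [ s ∷ ss ]ₙ = vals-sound sound (s ∷ ss)

    vals-sound : ∀ {j L M t} → Sound (suc j) L M t → ∀ ss → Describesₙ M (vals j L t ss) ss
    vals-sound {M = M} sound []       = emptyₙ-sound M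
    vals-sound {M = M} {t} sound (s ∷ ss) = consₙ-sound s ss (val-sound {t = t} (Sound-next {M = M} {t} sound) s) (vals-sound {t = t} sound ss)

  out-repl : ∀ j L c κ → proj₂ (out j L (repl j L c κ)) ≡ κ
  out-repl zero    L c κ = refl
  out-repl (suc j) L c κ = cong proj₂ (out-repl j (next L) c _)

  -- `Represents-repl` moves the tuple to the surroundings `e′`, where the sound entry speaks of the
  -- same `s`.
  topVal-sound : ∀ {j L M t} → Sound j L M t → ∀ {a} c s e → top₁ s ≡ just a → Represents j L M c s e →
    Describes M (topVal j L t a c) (λ e → φ M e s) (body s)
  topVal-sound {j} {L} {M} {t} sound {a} c s e top r κ e′ κ⊲ =
    (λ bit → sound s e′ top r′ (subst T (cong proj₁ (run-mk L _ κ)) bit)) ,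
    (begin
      proj₂ (run L (topVal j L t a c) κ)                          ≡⟨ cong proj₂ (run-mk L _ κ) ⟩
      back (brackets j a) (future (bot j L) (repl j L c κ))       ≡⟨ Represents-future j L M (repl j L c κ) s e′ r′ top ⟩
      back (body s) (future L (proj₂ (out j L (repl j L c κ))))   ≡⟨ cong (λ κ′ → back (body s) (future L κ′)) (out-repl j L c κ) ⟩
      back (body s) (future L κ)                                  ∎)
    where
    open ≡-Reasoning
    r′ : Represents j L M (repl j L c κ) s e′
    r′ = Represents-repl j L M c s e κ e′ r κ⊲

  pop-sound : ∀ j L M k c s e → Represents j L M c s e → T (popₖ-bit j L k c) →
    ∃[ s′ ] popₖ k s ≡ just s′ × φ M e s′
  pop-sound (suc j) L M k c [ s ∷ ss ]ₙ e r bit with does (k ≟ℕ 2 + j)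
  pop-sound (suc j) L M k c [ s ∷ ss ]ₙ e r bit | false
    with pop-sound j (next L) (nextM M) k c s (ss , e) r bit
  ... | s′ , eq , φs′ = _ , cong (Maybe.map _) eq , φs′
  pop-sound (suc j) L M k c [ s ∷ ss ]ₙ e r bit | true
    with ss | Represents-out j (next L) (nextM M) c s (ss , e) r
  -- With one store left the tail is empty, and `φ-list` forbids a set bit.
  ... | []       | x-ss , κ⊲ = ⊥-elim (proj₁ (x-ss _ e κ⊲) bit)
  ... | s′ ∷ ss′ | x-ss , κ⊲ = _ , refl , proj₁ (x-ss _ e κ⊲) bit

  push-sound : ∀ j L M t → Sound j L M t → ∀ k {a} c s e → top₁ s ≡ just a → Represents j L M c s e →
    T (pushₖ-bit j L t k a c) → ∃[ s′ ] pushₖ k s ≡ just s′ × φ M e s′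
  push-sound (suc j) L M t sound k c [ s ∷ ss ]ₙ e top r bit with does (k ≟ℕ 2 + j)
  -- `y-s` serves both copies: the lower one as head of the list to the right, the upper one as the
  -- store on top of that list.
  ... | true = _ , refl , proj₁ (y-s _ (s ∷ ss , e) (consₙ-sound s ss y-s (proj₁ xκ⊲) , proj₂ xκ⊲)) bit
    where
    xκ⊲ = Represents-out j (next L) (nextM M) c s (ss , e) r
    y-s = topVal-sound {M = nextM M} {t} (Sound-next {M = M} {t} sound) c s (ss , e) top r
  ... | false with push-sound j (next L) (nextM M) t (Sound-next {M = M} {t} sound) k c s (ss , e) top r bit
  ... | s′ , eq , φs′ = _ , cong (Maybe.map _) eq , φs′

  push₁-sound : ∀ j L M t → Sound j L M t → ∀ w c s e → Represents j L M c s e →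
    T (push₁-bit j L t w c) → ∃[ s′ ] push₁ w s ≡ just s′ × φ M e s′
  push₁-sound zero L M t sound w c [ a ∷ as ]₁ e r bit =
    _ , refl , proj₁ (foldr-cons₁-sound {t = t} sound w (proj₁ r) (proj₂ c) e (proj₂ r)) bit
  push₁-sound (suc j) L M t sound w c [ s ∷ ss ]ₙ e r bit
    with push₁-sound j (next L) (nextM M) t (Sound-next {M = M} {t} sound) w c s (ss , e) r bit
  ... | s′ , eq , φs′ = _ , cong (Maybe.map _) eq , φs′

  -- Saturation of the table

  module Saturation {j : ℕ} (H : HCFP Γ (suc j)) where

    top : Frame
    top = record { K = ⊤ ; finite = ⊤-finite ; future = λ _ → final ; opens = [] }

    op-fires : Table j top → (a : Γ) → K (bot j top) → Γ × Op Γ (suc j) → Bool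
    op-fires t a c (b , o) = isYes (finite-≟ Γ-finite a b) ∧ op-bit o j top t a c

    step : Table j top → Table j top
    -- A represented store has the word `brackets (suc j) a` followed by what `c` describes, so the
    -- first disjunct asks whether `A` accepts the store itself.
    step t a c = accepting (brackets (suc j) a) (future (bot j top) c) ∨ any (op-fires t a c) H

    entries : ℕ
    entries = m * card (bot j top)

    entry : (Γ × K (bot j top)) ↪ Fin entries
    entry = ×-finite Γ-finite (finite (bot j top))

    abstract
      -- Tables are stored as subsets of the numbered entries, whose size measures the progress of
      -- the iteration.
      table : Subset entries → Table j top
      table p a c = lookup p (to entry (a , c))

      subset : Table j top → Subset entries
      subset t = tabulate (λ i → t (proj₁ (from entry i)) (proj₂ (from entry i)))

      table-∅ : ∀ a c → T (table ∅ a c) → ⊥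
      table-∅ a c bit with lookup ∅ (to entry (a , c)) in eq
      ... | true = ∉⊥ (lookup⇒[]= (to entry (a , c)) ∅ eq)

      table-⊆ : ∀ {p q} → p ⊆ q → ∀ a c → T (table p a c) → T (table q a c)
      table-⊆ {p} {q} p⊆q a c bit with lookup p (to entry (a , c)) in eq
      ... | true rewrite []=⇒lookup (p⊆q (lookup⇒[]= (to entry (a , c)) p eq)) = tt

      table-subset : ∀ t a c → table (subset t) a c ≡ t a c
      table-subset t a c = trans (lookup∘tabulate _ (to entry (a , c)))
        (cong (λ ac → t (proj₁ ac) (proj₂ ac)) (strictlyInverseʳ entry (a , c)))

      table-∪ : ∀ p q a c → T (table (p ∪ q) a c) → T (table p a c) ⊎ T (table q a c)
      table-∪ p q a c bit with lookup (p ∪ q) (to entry (a , c)) in eq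
      ... | true with x∈p∪q⁻ p q (lookup⇒[]= (to entry (a , c)) (p ∪ q) eq)
      ... | inj₁ i∈p rewrite []=⇒lookup i∈p = inj₁ tt
      ... | inj₂ i∈q rewrite []=⇒lookup i∈q = inj₂ tt

    -- `step` is not evidently monotone, since the table also determines the tuples at which it is
    -- looked up. The union makes the iteration inflationary all the same.
    refine : Subset entries → Subset entries
    refine p = p ∪ subset (step (table p))

    stable : ∃[ k ] refine (iterate refine k) ⊆ iterate refine k
    stable = iterate-stabilises refine (λ p → p⊆p∪q (subset (step (table p))))

    saturated : Table j top
    saturated = table (iterate refine (proj₁ stable))

    saturated-closed : ∀ a c → T (step saturated a c) → T (saturated a c)
    saturated-closed a c bit = table-⊆ (proj₂ stable) a c
      (table-⊆ (q⊆p∪q (iterate refine (proj₁ stable)) _) a c (subst T (sym (table-subset (step saturated) a c)) bit))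

    result : Algebra Γ j ((2 * 2 ^ size) ^ 1)
    result = algebra j top saturated

    target : Fin ((2 * 2 ^ size) ^ 1) → Bool
    target d = proj₁ (run top d tt)

    op-complete : ∀ {s s′ a} (o : Op Γ (suc j)) → top₁ s ≡ just a → apply o s ≡ just s′ →
      op-bit o j top saturated a (ctx j top saturated s tt) ≡ target (eval result s′)
    op-complete {s} (push₁-op w)    _  eq = push₁-complete j top saturated w s tt eq
    op-complete {s} (push-op k _ _) ta eq = push-complete j top saturated k s tt ta eq
    op-complete {s} (pop-op  k _ _) _  eq = pop-complete j top saturated k s tt eq

    target-step : ∀ {s a} → top₁ s ≡ just a →
      T (step saturated a (ctx j top saturated s tt)) → T (target (eval result s))
    target-step {s} ta bit = subst T (sym (cong proj₁ (run-top j top saturated s tt ta)))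
      (saturated-closed _ (ctx j top saturated s tt) bit)

    module _ {S : Pred (Store Γ (suc j)) 0ℓ} (A-S : A Recognizes S) where

      ∈⇒accepting : ∀ {s} → s ∈ S → T (accepting (word s) final)
      ∈⇒accepting {s} s∈S = accepting⁺ (word s) (Equivalence.from (A-S (word s)) (s , s∈S , refl))

      accepting⇒∈ : ∀ {s} → T (accepting (word s) final) → s ∈ S
      -- The recognizer yields some store of `S` with this word; unique readability makes it `s`.
      accepting⇒∈ {s} bit with Equivalence.to (A-S (word s)) (accepting⁻ (word s) bit)
      ... | s′ , s′∈S , eq with word-injective s′ s (cong (_++ []) eq)
      ... | refl , _ = s′∈S

      target-S : ∀ s → s ∈ S → T (target (eval result s))
      target-S s s∈S with top₁ s in eq
      ... | nothing = subst T (sym (run-no-top j top saturated s tt eq)) (∈⇒accepting s∈S)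
      ... | just a  = target-step eq (Equivalence.from T-∨ (inj₁ (subst T accepting-eq (∈⇒accepting s∈S))))
        where
        accepting-eq : accepting (word s) final ≡ accepting (brackets (suc j) a) (future (bot j top) (ctx j top saturated s tt))
        accepting-eq = trans (cong (λ w → accepting w final) (word-body s)) (cong (λ X → lookup (pre ⟦ X) start)
          (trans (sym (future-val j top saturated s tt)) (cong proj₂ (run-top j top saturated s tt eq))))

      -- A set bit travels back along the steps: the operation bit at the exact tuple equals the bit
      -- of the successor, and the table is closed under `step`.
      target-complete : ∀ {s s′} → s′ ∈ S → Star (Step H) s s′ → T (target (eval result s))
      target-complete s′∈S ε = target-S _ s′∈S
      target-complete {s} s′∈S ((a , o , ao∈H , ta , eq) ◅ steps) = target-step ta
        (Equivalence.from T-∨ (inj₂ (any⁺ (op-fires saturated a (ctx j top saturated s tt)) (lose ao∈H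
          (Equivalence.from T-∧ (fromWitness {a? = finite-≟ Γ-finite a a} refl , subst T (sym (op-complete o ta eq)) (target-complete s′∈S steps)))))))

      model : Model j top
      model = record
        { E        = ⊤
        ; φ        = λ _ → pre* H S
        ; _⊲_      = λ _ _ → ⊤
        ; accepted = λ s _ bit → s , accepting⇒∈ bit , ε
        }

      op-sound : ∀ {t} → Sound j top model t → ∀ {a c} s (o : Op Γ (suc j)) → top₁ s ≡ just a →
        Represents j top model c s tt → T (op-bit o j top t a c) → ∃[ s′ ] apply o s ≡ just s′ × pre* H S s′
      op-sound {t} sound {c = c} s (push₁-op w)    ta r = push₁-sound j top model t sound w c s tt r
      op-sound {t} sound {c = c} s (push-op k _ _) ta r = push-sound j top model t sound k c s tt ta r
      op-sound {t} sound {c = c} s (pop-op  k _ _) ta r = pop-sound j top model k c s tt r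

      step-sound : ∀ {t} → Sound j top model t → Sound j top model (step t)
      step-sound {t} sound {a} {c} s e ta r bit with Equivalence.to T-∨ bit
      ... | inj₁ bit₁ = s , accepting⇒∈ (subst T accepting-eq bit₁) , ε
        where
        accepting-eq : accepting (brackets (suc j) a) (future (bot j top) c) ≡ accepting (word s) final
        accepting-eq = trans (cong (λ X → lookup (pre ⟦ X) start) (Represents-future j top model c s tt r ta))
          (cong (λ w → accepting w final) (sym (word-body s)))
      ... | inj₂ fires with find (any⁻ (op-fires t a c) H fires)
      ... | (b , o) , bo∈H , ok with Equivalence.to (T-∧ {isYes (finite-≟ Γ-finite a b)}) ok
      ... | a≟b , bit′ with toWitness {a? = finite-≟ Γ-finite a b} a≟b
      ... | refl with op-sound {t} sound s o ta r bit′
      ... | s₁ , eq , s′ , s′∈S , steps = s′ , s′∈S , (a , o , bo∈H , ta , eq) ◅ steps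

      -- The empty table is vacuously sound, and each union adds only entries obtained from a sound
      -- table.
      iterate-sound : ∀ k → Sound j top model (table (iterate refine k))
      iterate-sound zero    s e ta r bit = ⊥-elim (table-∅ _ _ bit)
      iterate-sound (suc k) {a} {c} s e ta r bit with table-∪ (iterate refine k) _ a c bit
      ... | inj₁ old = iterate-sound k s e ta r old
      ... | inj₂ new = step-sound {table (iterate refine k)} (iterate-sound k) s e ta r
        (subst T (table-subset (step (table (iterate refine k))) a c) new)

      target-correct : ∀ s → T (target (eval result s)) ⇔ s ∈ pre* H S
      target-correct s = mk⇔
        (proj₁ (val-sound {t = saturated} (iterate-sound (proj₁ stable)) s tt tt tt))
        (λ (s′ , s′∈S , steps) → target-complete s′∈S steps)

-- Automata for folds over finite sets

module Transitions {L : Set} {m n : ℕ} (label : Fin m → L) {_⟶⟨_⟩_ : Fin n → Fin m → Fin n → Set}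
  (tr? : ∀ p y q → Dec (p ⟶⟨ y ⟩ q)) where

  triple? : ∀ ((p , y , q) : Fin n × Fin m × Fin n) → Dec (p ⟶⟨ y ⟩ q)
  triple? (p , y , q) = tr? p y q

  -- Transitions are selected by the index of a label, because labels may be automata, on which
  -- equality is not decided.
  enumerated : List (Fin n × L × Fin n)
  enumerated = map (λ (p , y , q) → p , label y , q)
    (filter triple? (cartesianProduct (allFin n) (cartesianProduct (allFin m) (allFin n))))

  ∈-enumerated⁺ : ∀ {p y q} → p ⟶⟨ y ⟩ q → (p , label y , q) ∈ˡ enumerated
  ∈-enumerated⁺ {p} {y} {q} tr = ∈-map⁺ _ (∈-filter⁺ triple?
    (∈-cartesianProduct⁺ (∈-allFin p) (∈-cartesianProduct⁺ (∈-allFin y) (∈-allFin q))) tr)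

  ∈-enumerated⁻ : ∀ {p l q} → (p , l , q) ∈ˡ enumerated → ∃[ y ] l ≡ label y × p ⟶⟨ y ⟩ q
  ∈-enumerated⁻ tr∈ with ∈-map⁻ _ tr∈
  ... | (p , y , q) , pyq∈ , refl = y , refl , proj₂ (∈-filter⁻ triple? {xs = cartesianProduct (allFin n) _} pyq∈)

T-lookup-tabulate : ∀ {n} (P : Fin n → Bool) i → i ∈ˢ tabulate P ⇔ T (P i)
T-lookup-tabulate P i = mk⇔
  (λ i∈ → subst T (trans (sym ([]=⇒lookup i∈)) (lookup∘tabulate P i)) tt)
  (λ Pi → lookup⇒[]= i _ (trans (lookup∘tabulate P i) (Equivalence.to T-≡ Pi)))

-- State suc x promises that the remaining word has value x, and state zero that
-- its value is in P.
module Fold {L : Set} {m n : ℕ} (label : Fin m → L) (e : Fin n) (act : Fin m → Fin n → Fin n) (P : Fin n → Bool) where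

  promise : Fin (suc n) → Fin n → Bool
  promise zero    x = P x
  promise (suc y) x = isYes (y ≟ᶠ x)

  _⟶⟨_⟩_ : Fin (suc n) → Fin m → Fin (suc n) → Set
  p ⟶⟨ y ⟩ zero  = ⊥
  p ⟶⟨ y ⟩ suc x = T (promise p (act y x))

  ⟶? : ∀ p y q → Dec (p ⟶⟨ y ⟩ q)
  ⟶? p y zero    = no λ ()
  ⟶? p y (suc x) = T? _

  open Transitions label ⟶?

  automaton : FA L
  automaton = record
    { size        = suc n
    ; start       = zero
    ; final       = tabulate (λ p → promise p e)
    ; transitions = enumerated
    }

  run-sound : ∀ {p w r} → r ∈ˢ FA.final automaton → Run automaton p w r →
    ∃[ ys ] w ≡ map label ys × T (promise p (foldr act e ys))
  run-sound r∈ [] = [] , refl , Equivalence.to (T-lookup-tabulate (λ p → promise p e) _) r∈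
  run-sound {p} r∈ (_∷_ {q = q} tr∈ run) with q | ∈-enumerated⁻ tr∈ | run-sound r∈ run
  ... | suc x | y , refl , tr | ys , refl , x≡ with toWitness {a? = x ≟ᶠ foldr act e ys} x≡
  ... | refl = y ∷ ys , refl , tr

  run-complete : ∀ p ys → T (promise p (foldr act e ys)) →
    ∃[ r ] r ∈ˢ FA.final automaton × Run automaton p (map label ys) r
  run-complete p []       ok = p , Equivalence.from (T-lookup-tabulate (λ p → promise p e) _) ok , []
  run-complete p (y ∷ ys) ok with run-complete (suc (foldr act e ys)) ys (fromWitness {a? = foldr act e ys ≟ᶠ foldr act e ys} refl)
  ... | r , r∈ , run = r , r∈ , ∈-enumerated⁺ {p} {y} {suc (foldr act e ys)} ok ∷ run

  automaton-correct : ∀ w → Accepts automaton w ⇔ (∃[ ys ] w ≡ map label ys × T (P (foldr act e ys)))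
  automaton-correct w = mk⇔ (λ (_ , r∈ , run) → run-sound r∈ run) λ { (ys , refl , ok) → run-complete zero ys ok }

-- Nested store automata

module Automata {Γ : Set} {m : ℕ} (Γ-finite : Γ ↪ Fin m) where

  mutual
    nested : ∀ {j n} → Algebra Γ j n → (Fin n → Bool) → NestedSA Γ (suc j)
    nested (base e act)   P = nested₁ (Fold.automaton (from Γ-finite) e (act ∘ from Γ-finite) P)
    nested (node e act A) P = nestedₙ (Fold.automaton (nested-value A) e act P)

    -- These are the letters of the automaton one level up: reading one of them amounts to guessing
    -- the value of a store.
    nested-value : ∀ {j n} → Algebra Γ j n → Fin n → NestedSA Γ (suc j)
    nested-value A x = nested A (λ y → isYes (x ≟ᶠ y))

  mutual
    nested-correct : ∀ {j n} (A : Algebra Γ j n) P s → NestedAccepts (nested A P) s ⇔ T (P (eval A s))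
    nested-correct (base e act) P [ as ]₁ = mk⇔
      (λ run → let (ys , eq , ok) = Equivalence.to (Fold.automaton-correct (from Γ-finite) e (act ∘ from Γ-finite) P as) run in
        subst (λ x → T (P x)) (trans (sym (foldr-map act (from Γ-finite) e ys)) (cong (foldr act e) (sym eq))) ok)
      (λ ok → Equivalence.from (Fold.automaton-correct (from Γ-finite) e (act ∘ from Γ-finite) P as)
        (map (to Γ-finite) as , sym (from-to as) , subst (λ x → T (P x)) (sym (trans (sym (foldr-map act (from Γ-finite) e (map (to Γ-finite) as))) (cong (foldr act e) (from-to as)))) ok))
      where
      from-to : ∀ as → map (from Γ-finite) (map (to Γ-finite) as) ≡ as
      from-to []       = refl
      from-to (a ∷ as) = cong₂ _∷_ (strictlyInverseʳ Γ-finite a) (from-to as)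
    nested-correct (node e act A) P [ ss ]ₙ = mk⇔
      (λ (Ns , run , pw) → let (ys , eq , ok) = Equivalence.to (Fold.automaton-correct (nested-value A) e act P Ns) run in
        subst (λ x → T (P x)) (values-sound A e act ys (toList ss) (subst (λ Ns → Pointwise NestedAccepts Ns (toList ss)) eq pw)) ok)
      (λ ok → map (nested-value A) (map (eval A) (toList ss)) ,
        Equivalence.from (Fold.automaton-correct (nested-value A) e act P _)
          (map (eval A) (toList ss) , refl , subst (λ x → T (P x)) (sym (foldr-map act (eval A) e (toList ss))) ok) ,
        values-complete A (toList ss))

    -- A store has only one value, so any guess `y` that admits it is that value.
    values-sound : ∀ {j n k} (A : Algebra Γ j n) (e : Fin k) act ys ss →
      Pointwise NestedAccepts (map (nested-value A) ys) ss → foldr act e ys ≡ foldr (λ s → act (eval A s)) e ss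
    values-sound A e act []       []       []         = refl
    values-sound A e act (y ∷ ys) (s ∷ ss) (run ∷ pw)
      with toWitness {a? = y ≟ᶠ eval A s} (Equivalence.to (nested-correct A _ s) run)
    ... | refl = cong (act (eval A s)) (values-sound A e act ys ss pw)

    values-complete : ∀ {j n} (A : Algebra Γ j n) ss →
      Pointwise NestedAccepts (map (nested-value A) (map (eval A) ss)) ss
    values-complete A []       = []
    values-complete A (s ∷ ss) =
      Equivalence.from (nested-correct A _ s) (fromWitness {a? = eval A s ≟ᶠ eval A s} refl) ∷ values-complete A ss

  -- Automata on the words of stores

  State : ∀ {j n} → Algebra Γ j n → Set
  State {n = n} (base e act)   = Fin n
  -- Left: between two stores of the list. Right: inside a store, with the value promised for the
  -- stores after it.
  State {n = n} (node e act A) = (Fin n × Bool) ⊎ (State A × Fin n)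

  states : ∀ {j n} → Algebra Γ j n → ℕ
  states {n = n} (base e act)   = n
  states {n = n} (node e act A) = n * 2 + states A * n

  State-finite : ∀ {j n} (A : Algebra Γ j n) → State A ↪ Fin (states A)
  State-finite (base e act)   = ↪-id _
  State-finite (node e act A) = ↔⇒↪ (↔-sym +↔⊎) ↪-∘
    (×-finite (↪-id _) (↔⇒↪ (↔-sym 2↔Bool)) ⊎-↪ ×-finite (State-finite A) (↪-id _))

  -- A state promises the value of what is left of each open list; the Boolean
  -- of a list of stores records that the list is nonempty.
  enter : ∀ {j n} (A : Algebra Γ j n) → Fin n → State A
  enter (base e act)   x = x
  enter (node e act A) x = inj₁ (x , false)

  Exit : ∀ {j n} (A : Algebra Γ j n) → State A → Set
  Exit (base e act)   x              = x ≡ e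
  Exit (node e act A) (inj₁ (x , b)) = x ≡ e × b ≡ true
  Exit (node e act A) (inj₂ _)       = ⊥

  Exit? : ∀ {j n} (A : Algebra Γ j n) q → Dec (Exit A q)
  Exit? (base e act)   x              = x ≟ᶠ e
  Exit? (node e act A) (inj₁ (x , b)) = (x ≟ᶠ e) ×-dec (b ≟ᵇ true)
  Exit? (node e act A) (inj₂ _)       = no λ ()

  Move : ∀ {j n} (A : Algebra Γ j n) → State A → Γ′ Γ → State A → Set
  Move (base e act)   x              (letter a) x′                = act a x′ ≡ x
  Move (base e act)   x              ⟦          x′                = ⊥
  Move (base e act)   x              ⟧          x′                = ⊥
  Move (node e act A) (inj₁ (x , b)) c          (inj₁ _)          = ⊥
  -- The opening bracket is where the values `y` of the coming store and `x′` of the stores after it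
  -- are guessed.
  Move (node e act A) (inj₁ (x , b)) ⟦          (inj₂ (q , x′))   = ∃[ y ] q ≡ enter A y × act y x′ ≡ x
  Move (node e act A) (inj₁ (x , b)) ⟧          (inj₂ (q , x′))   = ⊥
  Move (node e act A) (inj₁ (x , b)) (letter a) (inj₂ (q , x′))   = ⊥
  Move (node e act A) (inj₂ (q , x)) c          (inj₂ (q′ , x′))  = Move A q c q′ × x ≡ x′
  Move (node e act A) (inj₂ (q , x)) ⟧          (inj₁ (x′ , b))   = Exit A q × x ≡ x′ × b ≡ true
  Move (node e act A) (inj₂ (q , x)) ⟦          (inj₁ (x′ , b))   = ⊥
  Move (node e act A) (inj₂ (q , x)) (letter a) (inj₁ (x′ , b))   = ⊥

  Move? : ∀ {j n} (A : Algebra Γ j n) p c q → Dec (Move A p c q)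
  Move? (base e act)   x              (letter a) x′                = act a x′ ≟ᶠ x
  Move? (base e act)   x              ⟦          x′                = no λ ()
  Move? (base e act)   x              ⟧          x′                = no λ ()
  Move? (node e act A) (inj₁ (x , b)) c          (inj₁ _)          = no λ ()
  Move? (node e act A) (inj₁ (x , b)) ⟦          (inj₂ (q , x′))   =
    anyᶠ? λ y → finite-≟ (State-finite A) q (enter A y) ×-dec (act y x′ ≟ᶠ x)
  Move? (node e act A) (inj₁ (x , b)) ⟧          (inj₂ (q , x′))   = no λ ()
  Move? (node e act A) (inj₁ (x , b)) (letter a) (inj₂ (q , x′))   = no λ ()
  Move? (node e act A) (inj₂ (q , x)) c          (inj₂ (q′ , x′))  = Move? A q c q′ ×-dec (x ≟ᶠ x′)
  Move? (node e act A) (inj₂ (q , x)) ⟧          (inj₁ (x′ , b))   = Exit? A q ×-dec (x ≟ᶠ x′) ×-dec (b ≟ᵇ true)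
  Move? (node e act A) (inj₂ (q , x)) ⟦          (inj₁ (x′ , b))   = no λ ()
  Move? (node e act A) (inj₂ (q , x)) (letter a) (inj₁ (x′ , b))   = no λ ()

  data Path {j n} (A : Algebra Γ j n) : State A → List (Γ′ Γ) → State A → Set where
    []  : ∀ {q} → Path A q [] q
    _∷_ : ∀ {p c q w r} → Move A p c q → Path A q w r → Path A p (c ∷ w) r

  word-++ : ∀ {j} (s : Store Γ (suc j)) u → word s ++ u ≡ ⟦ ∷ inner s ++ ⟧ ∷ u
  word-++ s u = trans (cong (_++ u) (word-body s)) (cong (⟦ ∷_) (++-assoc (inner s) (⟧ ∷ []) u))

  letters-sound : ∀ {n} (e : Fin n) act {x u r} → Path (base e act) x u r → r ≡ e →
    ∃[ as ] map letter as ≡ u × foldr act e as ≡ x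
  letters-sound e act [] r≡e = [] , refl , sym r≡e
  letters-sound e act (_∷_ {c = letter a} tr path) r≡e with letters-sound e act path r≡e
  ... | as , refl , refl = a ∷ as , refl , tr

  mutual
    path-sound : ∀ {j n} (A : Algebra Γ j n) {x u r} → Path A (enter A x) u r → Exit A r →
      ∃[ s ] inner s ≡ u × eval A s ≡ x
    path-sound (base e act) path exit with letters-sound e act path exit
    ... | as , u≡ , x≡ = [ as ]₁ , u≡ , x≡
    -- `enter` sets the flag to `false`, so an empty list cannot exit.
    path-sound (node e act A) [] (_ , ())
    path-sound (node e act A) (tr ∷ path) exit with first-sound e act A tr path exit
    ... | s , ss , u≡ , x≡ = [ s ∷ ss ]ₙ , u≡ , x≡

    rest-sound : ∀ {j n k} (e : Fin n) act (A : Algebra Γ j k) {x b u r} → Path (node e act A) (inj₁ (x , b)) u r →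
      Exit (node e act A) r → ∃[ ss ] concatMap word ss ≡ u × foldr (λ s → act (eval A s)) e ss ≡ x
    rest-sound e act A [] (x≡e , _) = [] , refl , sym x≡e
    rest-sound e act A (tr ∷ path) exit with first-sound e act A tr path exit
    ... | s , ss , u≡ , x≡ = s ∷ ss , u≡ , x≡

    first-sound : ∀ {j n k} (e : Fin n) act (A : Algebra Γ j k) {x b c q u r} → Move (node e act A) (inj₁ (x , b)) c q →
      Path (node e act A) q u r → Exit (node e act A) r →
      ∃[ s ] ∃[ ss ] concatMap word (s ∷ ss) ≡ c ∷ u × foldr (λ s → act (eval A s)) e (s ∷ ss) ≡ x
    first-sound e act A {c = ⟦} {q = inj₂ (q , x′)} (y , refl , act≡) path exit with inside-sound e act A path exit
    ... | v , r , ss , inner-path , inner-exit , refl , refl with path-sound A inner-path inner-exit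
    ... | s , refl , refl = s , ss , word-++ s (concatMap word ss) , act≡

    -- The first move back to the left summand reads the bracket that closes the current store. All
    -- moves before it are moves of the inner automaton.
    inside-sound : ∀ {j n k} (e : Fin n) act (A : Algebra Γ j k) {q x u r} → Path (node e act A) (inj₂ (q , x)) u r →
      Exit (node e act A) r →
      ∃[ v ] ∃[ r′ ] ∃[ ss ] Path A q v r′ × Exit A r′ × v ++ ⟧ ∷ concatMap word ss ≡ u ×
        foldr (λ s → act (eval A s)) e ss ≡ x
    inside-sound e act A [] ()
    inside-sound e act A (_∷_ {c = c} {q = inj₂ _} (tr , refl) path) exit with inside-sound e act A path exit
    ... | v , r′ , ss , inner-path , inner-exit , refl , x≡ = c ∷ v , r′ , ss , tr ∷ inner-path , inner-exit , refl , x≡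
    inside-sound e act A (_∷_ {c = ⟧} {q = inj₁ _} (exit′ , refl , refl) path) exit with rest-sound e act A path exit
    ... | ss , refl , x≡ = [] , _ , ss , [] , exit′ , refl , x≡

  inside-complete : ∀ {j n k} (e : Fin n) act (A : Algebra Γ j k) {q v r x u z} → Path A q v r → Exit A r →
    Path (node e act A) (inj₁ (x , true)) u z → Path (node e act A) (inj₂ (q , x)) (v ++ ⟧ ∷ u) z
  inside-complete e act A [] exit rest = (exit , refl , refl) ∷ rest
  inside-complete e act A (tr ∷ path) exit rest = (tr , refl) ∷ inside-complete e act A path exit rest

  mutual
    path-complete : ∀ {j n} (A : Algebra Γ j n) s → ∃[ r ] Exit A r × Path A (enter A (eval A s)) (inner s) r
    path-complete (base e act) [ as ]₁ = e , refl , letters-complete as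
      where
      letters-complete : ∀ as → Path (base e act) (foldr act e as) (map letter as) e
      letters-complete []       = []
      letters-complete (a ∷ as) = refl ∷ letters-complete as
    path-complete (node e act A) [ s ∷ ss ]ₙ = inj₁ (e , true) , (refl , refl) , first-complete e act A s ss

    -- The flag `b` is arbitrary: it is `false` at the first store of a list and `true` at the later
    -- ones.
    first-complete : ∀ {j n k} (e : Fin n) act (A : Algebra Γ j k) {b} s ss →
      Path (node e act A) (inj₁ (foldr (λ s → act (eval A s)) e (s ∷ ss) , b)) (concatMap word (s ∷ ss)) (inj₁ (e , true))
    first-complete e act A {b} s ss with path-complete A s
    ... | r , exit , path = subst (λ w → Path (node e act A) (inj₁ (foldr (λ s → act (eval A s)) e (s ∷ ss) , b)) w (inj₁ (e , true))) (sym (word-++ s (concatMap word ss)))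
      ((eval A s , refl , refl) ∷ inside-complete e act A path exit (rest-complete e act A ss))

    rest-complete : ∀ {j n k} (e : Fin n) act (A : Algebra Γ j k) ss →
      Path (node e act A) (inj₁ (foldr (λ s → act (eval A s)) e ss , true)) (concatMap word ss) (inj₁ (e , true))
    rest-complete e act A []       = []
    rest-complete e act A (s ∷ ss) = first-complete e act A s ss

  module Paths {j n : ℕ} (A : Algebra Γ j n) (x : Fin n) where
    open RightInverse (State-finite A) using () renaming (to to code; from to state; strictlyInverseʳ to state-code)
    open RightInverse (Γ′-finite Γ-finite) using () renaming (to to code′; from to symbol; strictlyInverseʳ to symbol-code)
    open Transitions symbol {λ p c q → Move A (state p) (symbol c) (state q)} (λ p c q → Move? A _ _ _)

    automaton : FA (Γ′ Γ)
    automaton = record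
      { size        = states A
      ; start       = code (enter A x)
      ; final       = tabulate (λ p → isYes (Exit? A (state p)))
      ; transitions = enumerated
      }

    run⇒path : ∀ {p w r} → Run automaton p w r → Path A (state p) w (state r)
    run⇒path [] = []
    run⇒path (tr∈ ∷ run) with ∈-enumerated⁻ tr∈
    ... | c , refl , tr = tr ∷ run⇒path run

    path⇒run : ∀ {p w r} → Path A p w r → Run automaton (code p) w (code r)
    path⇒run [] = []
    path⇒run {p} (_∷_ {c = c} {q = q} tr path) = subst (λ c → (code p , c , code q) ∈ˡ enumerated) (symbol-code c)
      (∈-enumerated⁺ {code p} {code′ c} {code q} move) ∷ path⇒run path
      where
      move : Move A (state (code p)) (symbol (code′ c)) (state (code q))
      move rewrite state-code p | symbol-code c | state-code q = tr

    automaton-correct : ∀ w → Accepts automaton w ⇔ (∃[ s ] inner s ≡ w × eval A s ≡ x)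
    automaton-correct w = mk⇔
      (λ (r , r∈ , run) → path-sound A (subst (λ p → Path A p w (state r)) (state-code (enter A x)) (run⇒path run))
        (toWitness {a? = Exit? A (state r)} (Equivalence.to (T-lookup-tabulate (λ p → isYes (Exit? A (state p))) r) r∈)))
      λ { (s , refl , refl) → let (r , exit , path) = path-complete A s in
        code r ,
        Equivalence.from (T-lookup-tabulate (λ p → isYes (Exit? A (state p))) (code r))
          (fromWitness {a? = Exit? A (state (code r))} (subst (Exit A) (sym (state-code r)) exit)) ,
        path⇒run path }

  -- A list of stores gets the value 0 if it is empty, 1 if it is a single store
  -- with value in P, and 2 otherwise, so that the words sought are the contents
  -- of the stores of value 1 at one level higher.
  module Words {j n : ℕ} (A : Algebra Γ j n) (P : Fin n → Bool) where

    single : Fin n → Fin 3 → Fin 3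
    single y zero    = if P y then suc zero else suc (suc zero)
    single y (suc _) = suc (suc zero)

    wrapped : Algebra Γ (suc j) 3
    wrapped = node zero single A

    single-one : ∀ s ss → eval wrapped [ s ∷ ss ]ₙ ≡ suc zero ⇔ (ss ≡ [] × T (P (eval A s)))
    single-one s ss = mk⇔ (to′ ss) from′
      where
      to′ : ∀ ss → eval wrapped [ s ∷ ss ]ₙ ≡ suc zero → ss ≡ [] × T (P (eval A s))
      to′ [] eq with P (eval A s)
      to′ [] eq | true = refl , tt
      to′ [] () | false
      -- The rest is nonempty, so its value is 1 or 2, and either makes the whole list 2.
      to′ (s′ ∷ ss) eq with foldr (λ s → single (eval A s)) zero ss
      to′ (s′ ∷ ss) eq | zero with P (eval A s′)
      to′ (s′ ∷ ss) () | zero | true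
      to′ (s′ ∷ ss) () | zero | false
      to′ (s′ ∷ ss) () | suc _
      from′ : ∀ {ss} → ss ≡ [] × T (P (eval A s)) → eval wrapped [ s ∷ ss ]ₙ ≡ suc zero
      from′ (refl , ok) with P (eval A s)
      ... | true = refl

    automaton : FA (Γ′ Γ)
    automaton = Paths.automaton wrapped (suc zero)

    automaton-correct : ∀ w → Accepts automaton w ⇔ (∃[ s ] T (P (eval A s)) × word s ≡ w)
    automaton-correct w = mk⇔
      (λ run → accepted (Equivalence.to (Paths.automaton-correct wrapped (suc zero) w) run))
      (λ (s , ok , eq) → Equivalence.from (Paths.automaton-correct wrapped (suc zero) w)
        ([ s ∷ [] ]ₙ , trans (++-identityʳ (word s)) eq , Equivalence.from (single-one s []) (refl , ok)))
      where
      accepted : ∃[ s ] inner s ≡ w × eval wrapped s ≡ suc zero → ∃[ s ] T (P (eval A s)) × word s ≡ w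
      accepted ([ s ∷ ss ]ₙ , eq , one) with Equivalence.to (single-one s ss) one
      ... | refl , ok = s , ok , trans (sym (++-identityʳ (word s))) eq

theorem1 : ∀ {Γ : Set} {m : ℕ} → Γ ↔ Fin m → (n : ℕ) → 1 ≤ n →
    ((H : HCFP Γ n) (S : Pred (Store Γ n) 0ℓ) → Regular S → Regular (pre* H S))
    × (Σ[ construct ∈ (HCFP Γ n → FA (Γ′ Γ) → FA (Γ′ Γ)) ]
    (∀ H A (S : Pred (Store Γ n) 0ℓ) → A Recognizes S →
    construct H A Recognizes pre* H S))
    × (Σ[ constructNested ∈ (HCFP Γ n → FA (Γ′ Γ) → NestedSA Γ n) ]
    (∀ H A (S : Pred (Store Γ n) 0ℓ) → A Recognizes S →
    constructNested H A NestedRecognizes pre* H S))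
theorem1 {Γ} Γ↔Fin (suc j) _ =
  (λ H S (A , A-S) → automaton H A , automaton-correct H A S A-S) ,
  (automaton , automaton-correct) ,
  (λ H A → nested (result A H) (target A H)) ,
  (λ H A S A-S s → target-correct A H A-S s ⇔-∘ nested-correct (result A H) (target A H) s)
  where
  Γ-finite : Γ ↪ Fin _
  Γ-finite = ↔⇒↪ Γ↔Fin

  open Automata Γ-finite
  open Values.Saturation Γ-finite using (result; target; target-correct)

  automaton : HCFP Γ (suc j) → FA (Γ′ Γ) → FA (Γ′ Γ)
  automaton H A = Words.automaton (result A H) (target A H)

  automaton-correct : ∀ H A S → A Recognizes S → automaton H A Recognizes pre* H S
  automaton-correct H A S A-S w =
    mk⇔
      (λ (s , ok , eq) → s , Equivalence.to (target-correct A H A-S s) ok , eq)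
      (λ (s , s∈ , eq) → s , Equivalence.from (target-correct A H A-S s) s∈ , eq)
    ⇔-∘ Words.automaton-correct (result A H) (target A H) w
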